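{- Let $\Phi=\forall u_1\ldots\forall u_n\exists e_1(D_1)\ldots\exists e_m(D_m).\varphi$ be a DQBF. If Algorithm 1 (as described in the context), run on $\Phi$, returns TRUE, then $\Phi$ is true; this holds for every admissible choice of the witnesses, definitions, satisfying assignments and cores made during the run.
   Context: For a set $V$ of variables, $[V]$ is the set of assignments $V\to\{\textsc{true},\textsc{false}\}$; assignments are identified with terms of the literals they make true, $\neg\sigma$ is the clause of the negations of these literals, and $\sigma|_W$ denotes restriction. A DQBF is $\Phi=\forall u_1\ldots\forall u_n\exists e_1(D_1)\ldots\exists e_m(D_m).\varphi$ with pairwise distinct variables, $U=\{u_i\}$, $E=\{e_j\}$, dependency sets $D(e_j)=D_j\subseteq U$, $\varphi$ a CNF over $U\cup E$; a model is a family $(f_e)_{e\in E}$, $f_e:[D(e)]\to\{\textsc{true},\textsc{false}\}$, such that for all $\sigma\in[U]$ the assignment $\sigma$ together with $e\mapsto f_e(\sigma|_{D(e)})$ satisfies $\varphi$; $\Phi$ is true iff it has a model. A definition of a variable $x$ by a set $X$ in a formula $\chi$ is a formula $\psi$ with $\mathit{var}(\psi)\subseteq X$ such that every satisfying assignment $\lambda$ of $\chi$ has $\lambda(x)=\psi[\lambda]$. Arbiter variables $e^\sigma$ ($e\in E$, $\sigma\in[D(e)]$) are fresh variables. Algorithm 1. Phase 1: set $A=\emptyset$, $\varphi_A=\emptyset$ (empty CNF), $\psi_{\mathit{Def}}=$ empty conjunction. For $i=1,\dots,m$: while $e_i$ has no definition by $A\cup D_i$ in $\varphi\wedge\varphi_A$,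 choose an assignment $\xi\in[D_i\cup A]$ such that both $\varphi\wedge\varphi_A\wedge\xi\wedge e_i$ and $\varphi\wedge\varphi_A\wedge\xi\wedge\neg e_i$ are satisfiable, let $\sigma=\xi|_{D_i}$, add the new variable $e_i^\sigma$ to $A$ and add the clauses $(e_i^\sigma\vee\neg\sigma\vee\neg e_i)$ and $(\neg e_i^\sigma\vee\neg\sigma\vee e_i)$ to $\varphi_A$. When $e_i$ has a definition by $A\cup D_i$ in $\varphi\wedge\varphi_A$, choose such a definition $\psi^i$ and conjoin $(e_i\leftrightarrow\psi^i)$ to $\psi_{\mathit{Def}}$. Phase 2: let $\tau\in[A]$ set all arbiter variables to true and let $\mathcal{C}=\emptyset$ (a set of clauses over $A$). Repeat: if $\neg\varphi\wedge\psi_{\mathit{Def}}\wedge\tau$ is unsatisfiable, return TRUE. Otherwise choose a satisfying assignment $\sigma$ of it, choose a subset $\rho$ of the literals of $\tau\wedge\sigma|_U$ such that $\varphi\wedge\varphi_A\wedge\rho$ is unsatisfiable, add the clause $\neg(\rho|_A)$ to $\mathcal{C}$; if $\mathcal{C}$ is satisfiable, let $\tau\in[A]$ be a satisfying assignment of $\mathcal{C}$ (extended arbitrarily to all of $A$) and repeat; otherwise return FALSE. -}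

module Defs where

open import Data.Bool using (Bool; true; false; not; _∧_; _∨_)
open import Data.Fin using (Fin)
open import Data.List using (List; []; _∷_; _++_; map; foldr; mapMaybe; allFin; [_])
open import Data.List.Relation.Binary.Subset.Propositional using (_⊆_)
open import Data.List.Relation.Unary.All as All using (All)
open import Data.List.Relation.Unary.All.Properties as AllP using ()
open import Data.List.Relation.Unary.Unique.Propositional using (Unique)
open import Data.Maybe using (Maybe; just; nothing)
open import Data.Nat using (ℕ)
open import Data.Product using (Σ; ∃; _×_; _,_)
open import Function using (_∘_)
open import Relation.Binary.PropositionalEquality using (_≡_)
open import Relation.Nullary using (¬_)

private variable
  X Y : Set

-- Finite sets of variables are duplicate-free lists.  An assignment of such a
-- set is first-order data (one Boolean per list entry), so that two assignments
-- with the same values are propositionally equal.  This matters because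
-- assignments of dependency sets are arguments of Skolem functions and indices
-- of arbiter variables.
Assignment : List X → Set
Assignment V = All (λ _ → Bool) V

Valuation : Set → Set
Valuation X = X → Bool

infix 8 _↾_
_↾_ : Valuation X → (V : List X) → Assignment V
v ↾ V = All.universal v V

data Literal (X : Set) : Set where
  pos neg : X → Literal X

mapLiteral : (X → Y) → Literal X → Literal Y
mapLiteral f (pos x) = pos (f x)
mapLiteral f (neg x) = neg (f x)

negate : Literal X → Literal X
negate (pos x) = neg x
negate (neg x) = pos x

Clause Term CNF : Set → Set
Clause X = List (Literal X)
Term X   = List (Literal X)
CNF X    = List (Clause X)

mapCNF : (X → Y) → CNF X → CNF Y
mapCNF f = map (map (mapLiteral f))

literal : X → Bool → Literal X
literal x true  = pos x
literal x false = neg x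

-- The term of the literals made true by an assignment.
term : {V : List X} → Assignment V → Term X
term = All.reduce (λ {x} b → literal x b)

negTerm : Term X → Clause X
negTerm = map negate

infix  9 `¬_
infixr 7 _`∧_
infixr 6 _`∨_
infix  5 _`↔_

data Formula (X : Set) : Set where
  `var           : X → Formula X
  `⊤ `⊥          : Formula X
  `¬_            : Formula X → Formula X
  _`∧_ _`∨_ _`↔_ : Formula X → Formula X → Formula X

iff : Bool → Bool → Bool
iff true  b = b
iff false b = not b

⟦_⟧ : Formula X → Valuation X → Bool
⟦ `var x ⟧  v = v x
⟦ `⊤ ⟧      v = true
⟦ `⊥ ⟧      v = false
⟦ `¬ χ ⟧    v = not (⟦ χ ⟧ v)
⟦ χ `∧ ψ ⟧  v = ⟦ χ ⟧ v ∧ ⟦ ψ ⟧ v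
⟦ χ `∨ ψ ⟧  v = ⟦ χ ⟧ v ∨ ⟦ ψ ⟧ v
⟦ χ `↔ ψ ⟧  v = iff (⟦ χ ⟧ v) (⟦ ψ ⟧ v)

vars : Formula X → List X
vars (`var x)  = [ x ]
vars `⊤        = []
vars `⊥        = []
vars (`¬ χ)    = vars χ
vars (χ `∧ ψ)  = vars χ ++ vars ψ
vars (χ `∨ ψ)  = vars χ ++ vars ψ
vars (χ `↔ ψ)  = vars χ ++ vars ψ

fromLiteral : Literal X → Formula X
fromLiteral (pos x) = `var x
fromLiteral (neg x) = `¬ `var x

fromClause : Clause X → Formula X
fromClause = foldr (λ l → fromLiteral l `∨_) `⊥

fromTerm : Term X → Formula X
fromTerm = foldr (λ l → fromLiteral l `∧_) `⊤

fromCNF : CNF X → Formula X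
fromCNF = foldr (λ c → fromClause c `∧_) `⊤

infix 4 _⊨_
_⊨_ : Valuation X → Formula X → Set
v ⊨ χ = ⟦ χ ⟧ v ≡ true

Satisfiable Unsatisfiable : Formula X → Set
Satisfiable χ   = ∃ λ v → v ⊨ χ
Unsatisfiable χ = ¬ Satisfiable χ

record IsDefinition (x : X) (W : List X) (χ ψ : Formula X) : Set where
  field
    vars⊆  : vars ψ ⊆ W
    agrees : ∀ v → v ⊨ χ → v x ≡ ⟦ ψ ⟧ v

HasDefinition : X → List X → Formula X → Set
HasDefinition x W χ = ∃ (IsDefinition x W χ)

data PrefixVar (n m : ℕ) : Set where
  univ : Fin n → PrefixVar n m
  exis : Fin m → PrefixVar n m

record DQBF (n m : ℕ) : Set where
  field
    D        : Fin m → List (Fin n)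
    D-unique : ∀ e → Unique (D e)
    matrix   : CNF (PrefixVar n m)

module _ {n m : ℕ} (Φ : DQBF n m) where
  open DQBF Φ

  SkolemFamily : Set
  SkolemFamily = (e : Fin m) → Assignment (D e) → Bool

  extend : SkolemFamily → Valuation (Fin n) → Valuation (PrefixVar n m)
  extend f σ (univ u) = σ u
  extend f σ (exis e) = f e (σ ↾ D e)

  IsModel : SkolemFamily → Set
  IsModel f = ∀ σ → extend f σ ⊨ fromCNF matrix

  IsTrue : Set
  IsTrue = ∃ IsModel

data Result : Set where
  TRUE FALSE : Result

module Algorithm {n m : ℕ} (Φ : DQBF n m) where
  open DQBF Φ

  Arbiter : Set
  Arbiter = Σ (Fin m) λ e → Assignment (D e)

  data Var : Set where
    prefix  : PrefixVar n m → Var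
    arbiter : Arbiter → Var

  uvar : Fin n → Var
  uvar u = prefix (univ u)

  evar : Fin m → Var
  evar e = prefix (exis e)

  φ : Formula Var
  φ = fromCNF (mapCNF prefix matrix)

  record State : Set where
    constructor state
    field
      A    : List Arbiter
      φA   : CNF Var
      ψDef : Formula Var

  initial : State
  initial = state [] [] `⊤

  -- D(e) ∪ A
  scope : Fin m → List Arbiter → List Var
  scope e A = map uvar (D e) ++ map arbiter A

  restrictToD : ∀ e A → Assignment (scope e A) → Assignment (D e)
  restrictToD e A ξ = AllP.map⁻ (AllP.++⁻ˡ (map uvar (D e)) ξ)

  arbiterClauses : (e : Fin m) → Assignment (D e) → CNF Var
  arbiterClauses e σ =
      (pos (arbiter (e , σ)) ∷ ¬σ ++ [ neg (evar e) ])
    ∷ (neg (arbiter (e , σ)) ∷ ¬σ ++ [ pos (evar e) ])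
    ∷ []
    where
    ¬σ : Clause Var
    ¬σ = negTerm (map (mapLiteral uvar) (term σ))

  addArbiter : (e : Fin m) → Assignment (D e) → State → State
  addArbiter e σ (state A φA ψDef) =
    state ((e , σ) ∷ A) (arbiterClauses e σ ++ φA) ψDef

  addDefinition : Fin m → Formula Var → State → State
  addDefinition e ψ (state A φA ψDef) =
    state A φA (ψDef `∧ (`var (evar e) `↔ ψ))

  -- Phase1 es s s′: processing the existential variables es in order, starting
  -- from s, can end in s′.
  data Phase1 : List (Fin m) → State → State → Set where
    done : ∀ {s} → Phase1 [] s s

    -- The arbiter variable added here is automatically new: were it in A, its
    -- two clauses in φA would fix the value of e under ξ.
    arbitrate : ∀ {e es s s′} (let open State s) →
      ¬ HasDefinition (evar e) (scope e A) (φ `∧ fromCNF φA) →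
      (ξ : Assignment (scope e A)) →
      Satisfiable (φ `∧ fromCNF φA `∧ fromTerm (term ξ) `∧ `var (evar e)) →
      Satisfiable (φ `∧ fromCNF φA `∧ fromTerm (term ξ) `∧ `¬ `var (evar e)) →
      Phase1 (e ∷ es) (addArbiter e (restrictToD e A ξ) s) s′ →
      Phase1 (e ∷ es) s s′

    define : ∀ {e es s s′} (let open State s) →
      (ψ : Formula Var) →
      IsDefinition (evar e) (scope e A) (φ `∧ fromCNF φA) ψ →
      Phase1 es (addDefinition e ψ s) s′ →
      Phase1 (e ∷ es) s s′

  arbiterLiteral : Literal Var → Maybe (Literal Arbiter)
  arbiterLiteral (pos (arbiter a)) = just (pos a)
  arbiterLiteral (neg (arbiter a)) = just (neg a)
  arbiterLiteral (pos (prefix _))  = nothing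
  arbiterLiteral (neg (prefix _))  = nothing

  -- ρ|_A, for a term ρ all of whose arbiter variables belong to A.
  restrictToA : Term Var → Term Arbiter
  restrictToA = mapMaybe arbiterLiteral

  module _ (s : State) where
    open State s

    arbiterTerm : Assignment A → Term Var
    arbiterTerm τ = map (mapLiteral arbiter) (term τ)

    universalTerm : Valuation Var → Term Var
    universalTerm σ = map (mapLiteral uvar) (term ((σ ∘ uvar) ↾ allFin n))

    Counterexample : Assignment A → Formula Var
    Counterexample τ = `¬ φ `∧ ψDef `∧ fromTerm (arbiterTerm τ)

    record IsCore (τ : Assignment A) (σ : Valuation Var) (ρ : Term Var) : Set where
      field
        ρ⊆    : ρ ⊆ arbiterTerm τ ++ universalTerm σ
        unsat : Unsatisfiable (φ `∧ fromCNF φA `∧ fromTerm ρ)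

    learn : Term Var → CNF Arbiter → CNF Arbiter
    learn ρ 𝒞 = negTerm (restrictToA ρ) ∷ 𝒞

    -- Phase2 τ 𝒞 r: the main loop, entered with τ and 𝒞, can return r.
    data Phase2 : Assignment A → CNF Arbiter → Result → Set where
      return-true : ∀ {τ 𝒞} →
        Unsatisfiable (Counterexample τ) →
        Phase2 τ 𝒞 TRUE

      return-false : ∀ {τ 𝒞} σ ρ →
        σ ⊨ Counterexample τ →
        IsCore τ σ ρ →
        Unsatisfiable (fromCNF (learn ρ 𝒞)) →
        Phase2 τ 𝒞 FALSE

      repeat : ∀ {τ 𝒞 r} σ ρ →
        σ ⊨ Counterexample τ →
        IsCore τ σ ρ →
        (v : Valuation Arbiter) →
        v ⊨ fromCNF (learn ρ 𝒞) →
        Phase2 (v ↾ A) (learn ρ 𝒞) r →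
        Phase2 τ 𝒞 r

  allTrue : (A : List Arbiter) → Assignment A
  allTrue A = (λ _ → true) ↾ A

  -- Some run of the algorithm, i.e. some sequence of admissible choices, ends
  -- with result r.
  Returns : Result → Set
  Returns r = ∃ λ s → Phase1 (allFin m) initial s × Phase2 s (allTrue (State.A s)) [] r

{-# OPTIONS --safe #-}

-- Let τ be the arbiter assignment for which the counterexample check fails.
-- Fixing the arbiters to τ turns the definition ψᵉ of e, whose variables lie in
-- D(e) ∪ A, into a function of D(e) alone; these functions form a model.  Indeed
-- the assignment they induce over any σ satisfies ψ_Def ∧ τ, so, as
-- ¬φ ∧ ψ_Def ∧ τ is unsatisfiable, it satisfies φ.
module Submission where

open import Data.Bool using (true; false; not; _∧_; _∨_)
open import Data.Fin using (Fin; _≟_)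
open import Data.List using (List; []; _∷_; map)
open import Data.List.Membership.DecPropositional using (_∈?_)
open import Data.List.Membership.Propositional using (_∈_)
open import Data.List.Membership.Propositional.Properties using (∈-++⁺ˡ; ∈-++⁺ʳ; ∈-++⁻; ∈-map⁻)
open import Data.List.Relation.Binary.Subset.Propositional using (_⊆_)
open import Data.List.Relation.Unary.All as All using ()
open import Data.List.Relation.Unary.AllPairs using (_∷_)
open import Data.List.Relation.Unary.Any using (here; there)
open import Data.List.Relation.Unary.Unique.Propositional using (Unique)
open import Data.List.Relation.Unary.Unique.Propositional.Properties using (allFin⁺)
open import Data.Nat using (ℕ)
open import Data.Product using (∃; _,_)
open import Data.Sum using (inj₁; inj₂)
open import Function using (_∘_)
open import Relation.Binary.PropositionalEquality using (_≡_; _≢_; refl; sym; trans; cong; cong₂)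
open import Relation.Nullary using (yes; no; contradiction)
open import Defs

private variable
  X Y : Set

⟦⟧-cong-vars : (χ : Formula X) {v w : Valuation X} →
               (∀ {x} → x ∈ vars χ → v x ≡ w x) → ⟦ χ ⟧ v ≡ ⟦ χ ⟧ w
⟦⟧-cong-vars (`var x)  eq = eq (here refl)
⟦⟧-cong-vars `⊤        eq = refl
⟦⟧-cong-vars `⊥        eq = refl
⟦⟧-cong-vars (`¬ χ)    eq = cong not (⟦⟧-cong-vars χ eq)
⟦⟧-cong-vars (χ `∧ ψ)  eq = cong₂ _∧_ (⟦⟧-cong-vars χ (eq ∘ ∈-++⁺ˡ)) (⟦⟧-cong-vars ψ (eq ∘ ∈-++⁺ʳ (vars χ)))
⟦⟧-cong-vars (χ `∨ ψ)  eq = cong₂ _∨_ (⟦⟧-cong-vars χ (eq ∘ ∈-++⁺ˡ)) (⟦⟧-cong-vars ψ (eq ∘ ∈-++⁺ʳ (vars χ)))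
⟦⟧-cong-vars (χ `↔ ψ)  eq = cong₂ iff (⟦⟧-cong-vars χ (eq ∘ ∈-++⁺ˡ)) (⟦⟧-cong-vars ψ (eq ∘ ∈-++⁺ʳ (vars χ)))

module _ (f : X → Y) (v : Valuation Y) where

  ⟦mapLiteral⟧ : ∀ l → ⟦ fromLiteral (mapLiteral f l) ⟧ v ≡ ⟦ fromLiteral l ⟧ (v ∘ f)
  ⟦mapLiteral⟧ (pos x) = refl
  ⟦mapLiteral⟧ (neg x) = refl

  ⟦mapClause⟧ : ∀ c → ⟦ fromClause (map (mapLiteral f) c) ⟧ v ≡ ⟦ fromClause c ⟧ (v ∘ f)
  ⟦mapClause⟧ []      = refl
  ⟦mapClause⟧ (l ∷ c) = cong₂ _∨_ (⟦mapLiteral⟧ l) (⟦mapClause⟧ c)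

  ⟦mapTerm⟧ : ∀ t → ⟦ fromTerm (map (mapLiteral f) t) ⟧ v ≡ ⟦ fromTerm t ⟧ (v ∘ f)
  ⟦mapTerm⟧ []      = refl
  ⟦mapTerm⟧ (l ∷ t) = cong₂ _∧_ (⟦mapLiteral⟧ l) (⟦mapTerm⟧ t)

  ⟦mapCNF⟧ : ∀ φ → ⟦ fromCNF (mapCNF f φ) ⟧ v ≡ ⟦ fromCNF φ ⟧ (v ∘ f)
  ⟦mapCNF⟧ []      = refl
  ⟦mapCNF⟧ (c ∷ φ) = cong₂ _∧_ (⟦mapClause⟧ c) (⟦mapCNF⟧ φ)

⊨-literal : (v : Valuation X) (x : X) → v ⊨ fromLiteral (literal x (v x))
⊨-literal v x with v x in eq
... | true  = eq
... | false = cong not eq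

⊨-term-↾ : (v : Valuation X) (V : List X) → v ⊨ fromTerm (term (v ↾ V))
⊨-term-↾ v []      = refl
⊨-term-↾ v (x ∷ V) = cong₂ _∧_ (⊨-literal v x) (⊨-term-↾ v V)

lookup-↾ : (v : Valuation X) {V : List X} {x : X} (x∈V : x ∈ V) → All.lookup (v ↾ V) x∈V ≡ v x
lookup-↾ v (here refl) = refl
lookup-↾ v (there x∈V) = lookup-↾ v x∈V

iff-reflexive : ∀ {a b} → a ≡ b → iff a b ≡ true
iff-reflexive {true}  refl = refl
iff-reflexive {false} refl = refl

-- Variables outside V get the junk value false.
toValuation : ∀ {n} {V : List (Fin n)} → Assignment V → Valuation (Fin n)
toValuation {V = V} δ u with _∈?_ _≟_ u V
... | yes u∈V = All.lookup δ u∈V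
... | no  _   = false

toValuation-↾ : ∀ {n} (v : Valuation (Fin n)) {V u} → u ∈ V → toValuation (v ↾ V) u ≡ v u
toValuation-↾ v {V} {u} u∈V with _∈?_ _≟_ u V
... | yes p   = lookup-↾ v p
... | no  u∉V = contradiction u∈V u∉V

module _ {n m : ℕ} (Φ : DQBF n m) where
  open DQBF Φ
  open Algorithm Φ

  -- `arbiters` is the arbiter set at the moment `e` is defined. It is stored for each variable,
  -- since processing later variables may enlarge the set.
  record ScopedFormula (e : Fin m) : Set where
    constructor scoped
    field
      formula  : Formula Var
      arbiters : List Arbiter
      vars⊆    : vars formula ⊆ scope e arbiters
  open ScopedFormula

  _[_↦_] : (∀ e → ScopedFormula e) → (e : Fin m) → ScopedFormula e → (∀ e → ScopedFormula e)
  (d [ e ↦ ψ ]) e′ with e′ ≟ e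
  ... | yes refl = ψ
  ... | no  _    = d e′

  update-≡ : ∀ d e ψ → (d [ e ↦ ψ ]) e ≡ ψ
  update-≡ d e ψ with e ≟ e
  ... | yes refl = refl
  ... | no  e≢e  = contradiction refl e≢e

  update-≢ : ∀ d {e e′} ψ → e′ ≢ e → (d [ e ↦ ψ ]) e′ ≡ d e′
  update-≢ d {e} {e′} ψ e′≢e with e′ ≟ e
  ... | yes e′≡e = contradiction e′≡e e′≢e
  ... | no  _    = refl

  Obeys : Valuation Var → (∀ e → ScopedFormula e) → Fin m → Set
  Obeys w d e = w (evar e) ≡ ⟦ formula (d e) ⟧ w

  -- Induction on the run: `arbitrate` leaves `ψDef` as it is, and `define` adds one conjunct. By
  -- uniqueness, recording `ψ` for `e` overwrites no definition chosen later in the run.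
  phase1-definitions : ∀ {es s s′} → Unique es → Phase1 es s s′ →
    ∃ λ d → ∀ w → w ⊨ State.ψDef s → (∀ {e} → e ∈ es → Obeys w d e) → w ⊨ State.ψDef s′
  phase1-definitions _ done = (λ e → scoped `⊤ [] (λ ())) , λ w ⊨ψDef _ → ⊨ψDef
  phase1-definitions uniq (arbitrate _ _ _ _ run) = phase1-definitions uniq run
  phase1-definitions {e ∷ es} {s} (e∉es ∷ uniq) (define ψ isDef run)
    with d , sound ← phase1-definitions uniq run =
    d [ e ↦ ψₑ ] , λ w ⊨ψDef obeys →
      let value : w (evar e) ≡ ⟦ ψ ⟧ w
          value = trans (obeys (here refl)) (cong (λ χ → ⟦ formula χ ⟧ w) (update-≡ d e ψₑ))
      -- The remaining run starts from `ψDef` enlarged by the equivalence of `e` and `ψ`, which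
      -- `value` makes true.
      in sound w (cong₂ _∧_ ⊨ψDef (iff-reflexive value)) λ e′∈es →
           trans (obeys (there e′∈es))
                 (cong (λ χ → ⟦ formula χ ⟧ w) (update-≢ d ψₑ (All.lookup e∉es e′∈es ∘ sym)))
    where
    ψₑ : ScopedFormula e
    ψₑ = scoped ψ (State.A s) (IsDefinition.vars⊆ isDef)

  -- Every τ met in the loop is of the form v ↾ A; tracking v avoids proving that
  -- A has no duplicates.
  phase2-noCounterexample : ∀ s (v : Valuation Arbiter) {𝒞} → Phase2 s (v ↾ State.A s) 𝒞 TRUE →
    ∃ λ v′ → Unsatisfiable (Counterexample s (v′ ↾ State.A s))
  phase2-noCounterexample s v (return-true unsat)       = v , unsat
  phase2-noCounterexample s v (repeat _ _ _ _ v′ _ run) = phase2-noCounterexample s v′ run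

  module _ (d : ∀ e → ScopedFormula e) (v : Valuation Arbiter) where

    join : Valuation (PrefixVar n m) → Valuation Var
    join p (prefix x)  = p x
    join p (arbiter a) = v a

    -- Existential variables, which do not occur in formula (d e), are set to false.
    skolem : SkolemFamily Φ
    skolem e δ = ⟦ formula (d e) ⟧ (join (extend Φ (λ _ _ → false) (toValuation δ)))

    -- The valuation used inside `skolem` and the induced one can differ only on existential
    -- variables and on universal variables outside `D e`; the scope of `formula (d e)` excludes
    -- both.
    skolem-obeys : ∀ σ e → Obeys (join (extend Φ skolem σ)) d e
    skolem-obeys σ e = ⟦⟧-cong-vars (formula (d e)) (agree ∘ vars⊆ (d e))
      where
      agree : ∀ {x} → x ∈ scope e (arbiters (d e)) →
              join (extend Φ (λ _ _ → false) (toValuation (σ ↾ D e))) x ≡ join (extend Φ skolem σ) x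
      agree x∈ with ∈-++⁻ (map uvar (D e)) x∈
      ... | inj₁ x∈D with u , u∈D , refl ← ∈-map⁻ uvar x∈D    = toValuation-↾ σ u∈D
      ... | inj₂ x∈A with a , _   , refl ← ∈-map⁻ arbiter x∈A = refl

  returns-TRUE⇒IsTrue : Returns TRUE → IsTrue Φ
  returns-TRUE⇒IsTrue (s , run₁ , run₂)
    with d , sound ← phase1-definitions (allFin⁺ m) run₁
       -- The loop is entered with `allTrue`, which is by definition the restriction of this
       -- constant valuation.
       | v , unsat ← phase2-noCounterexample s (λ _ → true) run₂ = skolem d v , isModel
    where
    open State s

    isModel : IsModel Φ (skolem d v)
    -- `φ` is the matrix renamed along `prefix`, and `w ∘ prefix` is the Skolem extension of `σ` by
    -- computation.
    isModel σ = trans (sym (⟦mapCNF⟧ prefix w matrix)) ⊨φ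
      where
      w : Valuation Var
      w = join d v (extend Φ (skolem d v) σ)

      ⊨ψDef : w ⊨ ψDef
      -- `refl` suffices because phase 1 starts with `ψDef` equal to `⊤`.
      ⊨ψDef = sound w refl λ {e} _ → skolem-obeys d v σ e

      ⊨τ : w ⊨ fromTerm (arbiterTerm s (v ↾ A))
      ⊨τ = trans (⟦mapTerm⟧ arbiter w (term (v ↾ A))) (⊨-term-↾ v A)

      ⊨φ : w ⊨ φ
      ⊨φ with ⟦ φ ⟧ w in eq
      ... | true  = refl
      ... | false = contradiction (w , cong₂ _∧_ (cong not eq) (cong₂ _∧_ ⊨ψDef ⊨τ)) unsat

theorem1 : (n m : ℕ) (Φ : DQBF n m) → Algorithm.Returns Φ TRUE → IsTrue Φ
theorem1 n m Φ = returns-TRUE⇒IsTrue Φ
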